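{- The axiomatic system $\mathbf{K4}^\circ$ is sound and strongly complete with respect to the class of $\mathcal{S}4$-frames (reflexive and transitive frames). That is, with $F$ the class of reflexive and transitive frames, for every set $\Gamma\cup\{\phi\}$ of $\mathcal{L}(\circ)$-formulas, $\Gamma\vdash_{\mathbf{K4}^\circ}\phi$ if and only if $\Gamma\vDash_F\phi$.
   Context: Let $\mathbf{P}$ be a set of propositional variables, containing the distinct variables $p,q$ used in the axioms. The language $\mathcal{L}(\circ)$ is given by $\phi::=r\mid\neg\phi\mid(\phi\land\phi)\mid\circ\phi$ with $r\in\mathbf{P}$; other Boolean connectives and $\top$ are the usual abbreviations. A frame is $\langle S,R\rangle$ with $S$ a nonempty set and $R\subseteq S\times S$; it is reflexive/transitive if $R$ is. A model based on a frame is $\mathcal{M}=\langle S,R,V\rangle$ with $V:\mathbf{P}\to\mathcal{P}(S)$. Satisfaction: $\mathcal{M},s\vDash r$ iff $s\in V(r)$; Booleans as usual; $\mathcal{M},s\vDash\circ\phi$ iff ($\mathcal{M},s\vDash\phi$ implies that $\mathcal{M},t\vDash\phi$ for all $t$ with $sRt$). For a class $F$ of frames, $\Gamma\vDash_F\phi$ means: for every model $\mathcal{M}$ based on a frame in $F$ and every $s\in\mathcal{M}$, if $\mathcal{M},s\vDash\gamma$ for all $\gamma\in\Gamma$ then $\mathcal{M},s\vDash\phi$. The system $\mathbf{K}^\circ$ has as axioms all propositional tautologies, $\circ\top$, $\neg p\to\circ p$, and $\circ p\land\circ q\to\circ(p\land q)$, and as rules uniform substitution, modus ponens, and the rule: from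 $\phi\to\psi$ infer $\circ\phi\land\phi\to\circ\psi$. The system $\mathbf{K4}^\circ$ is $\mathbf{K}^\circ$ plus the axiom $\circ p\land p\to\circ\circ p$. A theorem of a system is a formula obtainable from its axioms by the rules. $\Gamma\vdash\phi$ means that there are $n\ge 0$ and $\gamma_1,\dots,\gamma_n\in\Gamma$ such that $\gamma_1\land\cdots\land\gamma_n\to\phi$ is a theorem (for $n=0$: $\phi$ is a theorem). -}

module Defs where

open import Data.Bool using (Bool; true; not) renaming (_∧_ to _∧ᵇ_)
open import Data.List using (List; []; _∷_; foldl)
open import Data.List.Relation.Unary.All using (All)
open import Data.Product using (∃-syntax; _×_)
open import Level using (0ℓ)
open import Relation.Binary.Core using (Rel)
open import Relation.Binary.Definitions using (Reflexive; Transitive)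
open import Relation.Binary.PropositionalEquality using (_≡_)
open import Relation.Nullary using (¬_)
open import Relation.Unary using (Pred; _∈_; _∪_)

infix  8 ∼_ ∘_
infixr 7 _∧_
infixr 6 _⇒_

data Form (P : Set) : Set where
  var : P → Form P
  ∼_  : Form P → Form P
  _∧_ : Form P → Form P → Form P
  ∘_  : Form P → Form P

_⇒_ : {P : Set} → Form P → Form P → Form P
φ ⇒ ψ = ∼ (φ ∧ (∼ ψ))

-- The language has no constants, so ⊤ is spelled with a given variable.
⊤[_] : {P : Set} → P → Form P
⊤[ p ] = ∼ (var p ∧ (∼ var p))

_[_] : {P : Set} → Form P → (P → Form P) → Form P
var r   [ σ ] = σ r
(∼ φ)   [ σ ] = ∼ (φ [ σ ])
(φ ∧ ψ) [ σ ] = (φ [ σ ]) ∧ (ψ [ σ ])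
(∘ φ)   [ σ ] = ∘ (φ [ σ ])

record Frame : Set₁ where
  field
    S        : Set
    nonempty : S
    R        : Rel S 0ℓ

record Model (P : Set) : Set₁ where
  field
    frame : Frame
  open Frame frame public
  field
    V : P → Pred S 0ℓ

_,_⊨_ : {P : Set} (M : Model P) → Model.S M → Form P → Set
M , s ⊨ var r   = s ∈ Model.V M r
M , s ⊨ (∼ φ)   = ¬ (M , s ⊨ φ)
M , s ⊨ (φ ∧ ψ) = (M , s ⊨ φ) × (M , s ⊨ ψ)
M , s ⊨ (∘ φ)   = M , s ⊨ φ → ∀ t → Model.R M s t → M , t ⊨ φ

_⊨[_]_ : {P : Set} → Pred (Form P) 0ℓ → Pred Frame 0ℓ → Form P → Set₁
_⊨[_]_ {P} Γ F φ =
  (M : Model P) → Model.frame M ∈ F → (s : Model.S M) →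
  (∀ γ → γ ∈ Γ → M , s ⊨ γ) → M , s ⊨ φ

S4-frames : Pred Frame 0ℓ
S4-frames 𝓕 = Reflexive R × Transitive R
  where open Frame 𝓕

-- Truth value of a formula under an assignment to its prime formulas, i.e.
-- variables and formulas ∘ φ; the values of v elsewhere are irrelevant.
eval : {P : Set} → (Form P → Bool) → Form P → Bool
eval v (var r) = v (var r)
eval v (∼ φ)   = not (eval v φ)
eval v (φ ∧ ψ) = eval v φ ∧ᵇ eval v ψ
eval v (∘ φ)   = v (∘ φ)

Tautology : {P : Set} → Pred (Form P) 0ℓ
Tautology φ = ∀ v → eval v φ ≡ true

data KAxiom {P : Set} (p q : P) : Pred (Form P) 0ℓ where
  taut : ∀ {φ} → Tautology φ → KAxiom p q φ
  ∘⊤   : KAxiom p q (∘ ⊤[ p ])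
  ∼⇒∘  : KAxiom p q ((∼ var p) ⇒ (∘ var p))
  ∘∧   : KAxiom p q (((∘ var p) ∧ (∘ var q)) ⇒ (∘ (var p ∧ var q)))

data Axiom4 {P : Set} (p : P) : Pred (Form P) 0ℓ where
  ∘4 : Axiom4 p (((∘ var p) ∧ var p) ⇒ (∘ (∘ var p)))

K4Axiom : {P : Set} → P → P → Pred (Form P) 0ℓ
K4Axiom p q = KAxiom p q ∪ Axiom4 p

data Theorem {P : Set} (Ax : Pred (Form P) 0ℓ) : Pred (Form P) 0ℓ where
  axiom : ∀ {φ} → φ ∈ Ax → Theorem Ax φ
  us    : ∀ {φ} (σ : P → Form P) → Theorem Ax φ → Theorem Ax (φ [ σ ])
  mp    : ∀ {φ ψ} → Theorem Ax (φ ⇒ ψ) → Theorem Ax φ → Theorem Ax ψ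
  rule∘ : ∀ {φ ψ} → Theorem Ax (φ ⇒ ψ) → Theorem Ax (((∘ φ) ∧ φ) ⇒ (∘ ψ))

-- γ₁ ∧ ⋯ ∧ γₙ → φ, associated to the left; just φ when n = 0.
⋀_⟹_ : {P : Set} → List (Form P) → Form P → Form P
⋀ []       ⟹ φ = φ
⋀ (γ ∷ γs) ⟹ φ = foldl _∧_ γ γs ⇒ φ

_⊢[_]_ : {P : Set} → Pred (Form P) 0ℓ → Pred (Form P) 0ℓ → Form P → Set
Γ ⊢[ Ax ] φ = ∃[ γs ] All (_∈ Γ) γs × Theorem Ax (⋀ γs ⟹ φ)

{-# OPTIONS --safe #-}
-- Soundness is an induction on theorems.  For completeness, a world of the
-- canonical model is a truth assignment to prime formulas that makes every
-- theorem true, and w sees u when u makes every φ true for which w makes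
-- ∘ φ ∧ φ true.  This relation is always reflexive, and the axiom
-- ∘ p ∧ p → ∘ ∘ p makes it transitive.  If w refutes ∘ φ, then
-- { ψ ∣ w makes ∘ ψ ∧ ψ true } does not derive φ: otherwise ∘∧ (or ∘⊤) and the
-- rule for ∘ would give ∘ φ at w.  So w sees a world refuting φ.
--
-- P is arbitrary, so worlds come from a maximality principle instead of an
-- enumeration of formulas.  Excluded middle is assumed for all types, not only
-- for propositions, hence it decides and chooses at the same time; this
-- suffices for Zorn's lemma by way of a Bourbaki–Witt tower.
module Submission where

open import Axiom.ExcludedMiddle using (ExcludedMiddle)
open import Axiom.Extensionality.Propositional using (Extensionality)
open import Data.Bool using (Bool; true; false; not) renaming (_∧_ to _∧ᵇ_)
open import Data.Bool.Properties using (⇔→≡)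
open import Data.Empty using (⊥-elim)
open import Data.List using (List; []; _∷_; _++_; foldl)
open import Data.List.Relation.Unary.All as All using (All; []; _∷_)
open import Data.List.Relation.Unary.All.Properties using (++⁺; ++⁻ˡ; ++⁻ʳ)
open import Data.Product using (∃-syntax; _×_; _,_; proj₁; proj₂)
open import Data.Sum using (_⊎_; inj₁; inj₂)
open import Function.Base using (_∘′_; id)
open import Function.Bundles using (_⇔_; mk⇔; Equivalence)
open import Level using (0ℓ)
open import Relation.Binary.PropositionalEquality
  using (_≡_; _≢_; refl; sym; trans; cong; subst; subst₂)
open import Relation.Nullary using (¬_; Dec; yes; no; does; contradiction)
open import Relation.Nullary.Decidable using (dec-true; decidable-stable)
open import Relation.Unary using (Pred; _∈_; _∪_)
open import Defs

does⁻ : {A : Set} (a? : Dec A) → does a? ≡ true → A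
does⁻ (yes a) _ = a

-- Zorn's lemma for families of subsets.

module Zorn (em : ExcludedMiddle 0ℓ) (ext : Extensionality 0ℓ 0ℓ) {A : Set} where

  -- Bool-valued subsets form a type in `Set`, so excluded middle applies to statements quantifying
  -- over them.
  Subset : Set
  Subset = A → Bool

  infix 4 _⊆_
  _⊆_ : Subset → Subset → Set
  X ⊆ Y = ∀ a → X a ≡ true → Y a ≡ true

  ⊆-antisym : ∀ {X Y} → X ⊆ Y → Y ⊆ X → X ≡ Y
  ⊆-antisym X⊆Y Y⊆X = ext λ a → ⇔→≡ (mk⇔ (X⊆Y a) (Y⊆X a))

  _⊂_ : Subset → Subset → Set
  X ⊂ Y = X ⊆ Y × ¬ (Y ⊆ X)

  ⊆⇒≡⊎⊂ : ∀ {X Y} → X ⊆ Y → X ≡ Y ⊎ X ⊂ Y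
  ⊆⇒≡⊎⊂ {X} {Y} X⊆Y with em {Y ⊆ X}
  ... | yes Y⊆X = inj₁ (⊆-antisym X⊆Y Y⊆X)
  ... | no Y⊈X  = inj₂ (X⊆Y , Y⊈X)

  insert : A → Subset → Subset
  insert a X b = does (em {X b ≡ true ⊎ b ≡ a})

  insert⁻ : ∀ {a X b} → insert a X b ≡ true → X b ≡ true ⊎ b ≡ a
  insert⁻ = does⁻ em

  ⋃ : (Subset → Bool) → Subset
  ⋃ D a = does (em {∃[ X ] D X ≡ true × X a ≡ true})

  ⋃⁻ : ∀ D {a} → ⋃ D a ≡ true → ∃[ X ] D X ≡ true × X a ≡ true
  ⋃⁻ D = does⁻ em

  ⊆⋃ : ∀ D {X} → D X ≡ true → X ⊆ ⋃ D
  ⊆⋃ D {X} X∈D a a∈X = dec-true em (X , X∈D , a∈X)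

  ⋃⊆⊎⊈ : ∀ D Y → (⋃ D ⊆ Y) ⊎ (∃[ X ] D X ≡ true × ¬ (X ⊆ Y))
  ⋃⊆⊎⊈ D Y with em {∃[ X ] D X ≡ true × ¬ (X ⊆ Y)}
  ... | yes found = inj₂ found
  ... | no none   = inj₁ λ a a∈⋃ →
    let (X , X∈D , a∈X) = ⋃⁻ D a∈⋃ in
    decidable-stable em (λ X⊈Y → none (X , X∈D , X⊈Y)) a a∈X

  Chain : (Subset → Bool) → Set
  Chain D = ∀ {X Y} → D X ≡ true → D Y ≡ true → X ⊆ Y ⊎ Y ⊆ X

  module _ (C : Pred Subset 0ℓ) where

    Extension : Subset → Set
    Extension X = ∃[ a ] X a ≢ true × C (insert a X)

    extend : (X : Subset) → Dec (Extension X) → Subset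
    extend X (yes (a , _)) = insert a X
    extend X (no _)        = X

    next : Subset → Subset
    next X = extend X em

    ⊆next : ∀ X → X ⊆ next X
    ⊆next X b b∈X with em {Extension X}
    ... | yes (a , _) = dec-true em (inj₁ b∈X)
    ... | no _        = b∈X

    C-next : ∀ {X} → C X → C (next X)
    C-next {X} CX with em {Extension X}
    ... | yes (_ , _ , Ca) = Ca
    ... | no _             = CX

    next⊆⇒maximal : ∀ {X} → next X ⊆ X → ∀ a → C (insert a X) → X a ≡ true
    next⊆⇒maximal {X} next⊆ a Ca with em {Extension X}
    ... | yes (b , b∉X , _) = contradiction (next⊆ b (dec-true em (inj₂ refl))) b∉X
    ... | no none           = decidable-stable em (λ a∉X → none (a , a∉X , Ca))

    -- The families are Bool-valued to keep Tower in Set, so that excluded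
    -- middle applies to Tower itself.
    data Tower : Subset → Set where
      step  : ∀ {X} → Tower X → Tower (next X)
      union : ∀ D → (∀ {X} → D X ≡ true → Tower X) → Tower (⋃ D)

    -- The extreme points of the Bourbaki-Witt argument.
    Extreme : Subset → Set
    Extreme Z = ∀ {Y} → Tower Y → Y ⊂ Z → next Y ⊆ Z

    -- Induction on the tower of `Y`. At a step, `Y` equal to `Z` gives the second alternative, and
    -- `Y` strictly inside `Z` gives the first by extremeness. A union not inside `Z` has a member
    -- not inside `Z`, which already contains `next Z`.
    extreme-dichotomy : ∀ {Z Y} → Extreme Z → Tower Y → Y ⊆ Z ⊎ next Z ⊆ Y
    extreme-dichotomy extreme (step {Y} TY) with extreme-dichotomy extreme TY
    ... | inj₂ nextZ⊆Y = inj₂ λ a → ⊆next Y a ∘′ nextZ⊆Y a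
    ... | inj₁ Y⊆Z with ⊆⇒≡⊎⊂ Y⊆Z
    ...   | inj₁ refl = inj₂ λ _ → id
    ...   | inj₂ Y⊂Z  = inj₁ (extreme TY Y⊂Z)
    extreme-dichotomy {Z} extreme (union D TD) with ⋃⊆⊎⊈ D Z
    ... | inj₁ ⋃⊆Z = inj₁ ⋃⊆Z
    ... | inj₂ (X , X∈D , X⊈Z) with extreme-dichotomy extreme (TD X∈D)
    ...   | inj₁ X⊆Z     = contradiction X⊆Z X⊈Z
    ...   | inj₂ nextZ⊆X = inj₂ λ a → ⊆⋃ D X∈D a ∘′ nextZ⊆X a

    -- Induction on the tower of `Z`, using the dichotomy at an earlier stage. If `Y` is strictly
    -- inside a union, some member is not inside `Y`; that member strictly contains `Y`, hence
    -- contains `next Y`.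
    tower-extreme : ∀ {Z} → Tower Z → Extreme Z
    tower-extreme (step {Z} TZ) TY (_ , nextZ⊈Y)
      with extreme-dichotomy (tower-extreme TZ) TY
    ... | inj₂ nextZ⊆Y = contradiction nextZ⊆Y nextZ⊈Y
    ... | inj₁ Y⊆Z with ⊆⇒≡⊎⊂ Y⊆Z
    ...   | inj₁ refl = λ _ → id
    ...   | inj₂ Y⊂Z  = λ a → ⊆next Z a ∘′ tower-extreme TZ TY Y⊂Z a
    tower-extreme (union D TD) {Y} TY (_ , ⋃⊈Y) with ⋃⊆⊎⊈ D Y
    ... | inj₁ ⋃⊆Y = contradiction ⋃⊆Y ⋃⊈Y
    ... | inj₂ (X , X∈D , X⊈Y) with extreme-dichotomy (tower-extreme (TD X∈D)) TY
    ...   | inj₁ Y⊆X     = λ a → ⊆⋃ D X∈D a ∘′ tower-extreme (TD X∈D) TY (Y⊆X , X⊈Y) a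
    ...   | inj₂ nextX⊆Y = contradiction (λ a → nextX⊆Y a ∘′ ⊆next X a) X⊈Y

    tower-total : ∀ {X Y} → Tower X → Tower Y → X ⊆ Y ⊎ Y ⊆ X
    tower-total {X} {Y} TX TY with extreme-dichotomy (tower-extreme TY) TX
    ... | inj₁ X⊆Y     = inj₁ X⊆Y
    ... | inj₂ nextY⊆X = inj₂ λ a → nextY⊆X a ∘′ ⊆next Y a

    -- The union of the whole tower is in the tower, hence so is its successor, which therefore lies
    -- inside that union. The empty chain supplies the starting set; maximality is against adding
    -- one element.
    zorn : (∀ D → Chain D → (∀ {X} → D X ≡ true → C X) → C (⋃ D)) →
           ∃[ X ] C X × (∀ a → C (insert a X) → X a ≡ true)
    zorn C-⋃ = top , C-tower T-top , next⊆⇒maximal (⊆⋃ tower (dec-true em (step T-top)))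
      where
      C-tower : ∀ {X} → Tower X → C X
      C-tower (step TX)    = C-next (C-tower TX)
      C-tower (union D TD) =
        C-⋃ D (λ X∈D Y∈D → tower-total (TD X∈D) (TD Y∈D)) (λ X∈D → C-tower (TD X∈D))

      tower : Subset → Bool
      tower X = does (em {Tower X})

      top : Subset
      top = ⋃ tower

      T-top : Tower top
      T-top = union tower (does⁻ em)

-- Boolean evaluation of formulas.

infix 4 _⊩_
_⊩_ : {P : Set} → (Form P → Bool) → Form P → Set
v ⊩ φ = eval v φ ≡ true

module _ {P : Set} {v : Form P → Bool} where

  ⊩-∧⁺ : ∀ φ ψ → v ⊩ φ → v ⊩ ψ → v ⊩ φ ∧ ψ
  ⊩-∧⁺ φ ψ vφ vψ rewrite vφ = vψ

  ⊩-∧⁻ : ∀ φ ψ → v ⊩ φ ∧ ψ → v ⊩ φ × v ⊩ ψ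
  ⊩-∧⁻ φ ψ h with eval v φ
  ... | true = refl , h

  ⊩-⇒⁺ : ∀ φ ψ → (v ⊩ φ → v ⊩ ψ) → v ⊩ φ ⇒ ψ
  ⊩-⇒⁺ φ ψ h with eval v φ
  ... | false = refl
  ... | true rewrite h refl = refl

  ⊩-⇒⁻ : ∀ φ ψ → v ⊩ φ ⇒ ψ → v ⊩ φ → v ⊩ ψ
  ⊩-⇒⁻ φ ψ h vφ rewrite vφ with eval v ψ
  ... | true = refl

  ⊩-foldl⁺ : ∀ γ γs → v ⊩ γ → All (v ⊩_) γs → v ⊩ foldl _∧_ γ γs
  ⊩-foldl⁺ γ []       vγ []         = vγ
  ⊩-foldl⁺ γ (δ ∷ γs) vγ (vδ ∷ vγs) = ⊩-foldl⁺ (γ ∧ δ) γs (⊩-∧⁺ γ δ vγ vδ) vγs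

  ⊩-foldl⁻ : ∀ γ γs → v ⊩ foldl _∧_ γ γs → v ⊩ γ × All (v ⊩_) γs
  ⊩-foldl⁻ γ []       h = h , []
  ⊩-foldl⁻ γ (δ ∷ γs) h =
    let vγδ , vγs = ⊩-foldl⁻ (γ ∧ δ) γs h
        vγ , vδ   = ⊩-∧⁻ γ δ vγδ
    in vγ , vδ ∷ vγs

  ⊩-⋀⁺ : ∀ γs φ → (All (v ⊩_) γs → v ⊩ φ) → v ⊩ ⋀ γs ⟹ φ
  ⊩-⋀⁺ []       φ h = h []
  ⊩-⋀⁺ (γ ∷ γs) φ h = ⊩-⇒⁺ (foldl _∧_ γ γs) φ λ vγs →
    let vγ , vγs′ = ⊩-foldl⁻ γ γs vγs in h (vγ ∷ vγs′)

  ⊩-⋀⁻ : ∀ γs φ → v ⊩ ⋀ γs ⟹ φ → All (v ⊩_) γs → v ⊩ φ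
  ⊩-⋀⁻ []       φ h []         = h
  ⊩-⋀⁻ (γ ∷ γs) φ h (vγ ∷ vγs) = ⊩-⇒⁻ (foldl _∧_ γ γs) φ h (⊩-foldl⁺ γ γs vγ vγs)

-- Soundness.

module Soundness (em : ExcludedMiddle 0ℓ) {P : Set} where

  truth : (M : Model P) → Model.S M → Form P → Bool
  truth M s φ = does (em {M , s ⊨ φ})

  -- Satisfaction at a point is itself an assignment to prime formulas, so tautologies hold there by
  -- evaluation.
  truth⇔⊨ : ∀ M s φ → (truth M s ⊩ φ) ⇔ (M , s ⊨ φ)
  truth⇔⊨ M s φ = mk⇔ (to φ) (from φ)
    where
    to   : ∀ φ → truth M s ⊩ φ → M , s ⊨ φ
    from : ∀ φ → M , s ⊨ φ → truth M s ⊩ φ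
    to (var r) h    = does⁻ em h
    to (∼ φ) h sφ   = contradiction (trans (sym h) (cong not (from φ sφ))) λ ()
    to (φ ∧ ψ) h    = let hφ , hψ = ⊩-∧⁻ φ ψ h in to φ hφ , to ψ hψ
    to (∘ φ) h      = does⁻ em h
    from (var r) sr = dec-true em sr
    from (∼ φ) s∼φ with eval (truth M s) φ in eq
    ... | true  = ⊥-elim (s∼φ (to φ eq))
    ... | false = refl
    from (φ ∧ ψ) (sφ , sψ) = ⊩-∧⁺ φ ψ (from φ sφ) (from ψ sψ)
    from (∘ φ) s∘φ         = dec-true em s∘φ

  _[_]ᴹ : Model P → (P → Form P) → Model P
  M [ σ ]ᴹ = record { frame = Model.frame M ; V = λ r s → M , s ⊨ σ r }

  ⊨-subst : ∀ M σ φ s → (M , s ⊨ (φ [ σ ])) ⇔ ((M [ σ ]ᴹ) , s ⊨ φ)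
  ⊨-subst M σ φ s = mk⇔ (to φ s) (from φ s)
    where
    to   : ∀ φ s → M , s ⊨ (φ [ σ ]) → (M [ σ ]ᴹ) , s ⊨ φ
    from : ∀ φ s → (M [ σ ]ᴹ) , s ⊨ φ → M , s ⊨ (φ [ σ ])
    to (var r) s h             = h
    to (∼ φ) s h sφ            = h (from φ s sφ)
    to (φ ∧ ψ) s (sφ , sψ)     = to φ s sφ , to ψ s sψ
    to (∘ φ) s h sφ t sRt      = to φ t (h (from φ s sφ) t sRt)
    from (var r) s h           = h
    from (∼ φ) s h sφ          = h (to φ s sφ)
    from (φ ∧ ψ) s (sφ , sψ)   = from φ s sφ , from ψ s sψ
    from (∘ φ) s h sφ t sRt    = from φ t (h (to φ s sφ) t sRt)

  -- `M` and `s` vary in the induction: `us` changes the valuation over the same frame, and `rule∘`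
  -- moves to a successor.
  theorem-sound : ∀ {p q φ} → Theorem (K4Axiom p q) φ →
                  ∀ M → Model.frame M ∈ S4-frames → ∀ s → M , s ⊨ φ
  theorem-sound {φ = φ} (axiom (inj₁ (taut τ))) M _ s =
    Equivalence.to (truth⇔⊨ M s φ) (τ (truth M s))
  theorem-sound (axiom (inj₁ ∘⊤)) M _ s _ t _ (tp , t∼p) = t∼p tp
  theorem-sound (axiom (inj₁ ∼⇒∘)) M _ s (s∼p , s∼∘p) =
    s∼∘p λ sp → ⊥-elim (s∼p sp)
  theorem-sound (axiom (inj₁ ∘∧)) M _ s ((s∘p , s∘q) , h) =
    h λ (sp , sq) t sRt → s∘p sp t sRt , s∘q sq t sRt
  theorem-sound (axiom (inj₂ ∘4)) M (_ , R-trans) s ((s∘p , sp) , h) =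
    h λ _ t sRt _ u tRu → s∘p sp u (R-trans sRt tRu)
  theorem-sound (us {φ} σ ⊢φ) M F s =
    Equivalence.from (⊨-subst M σ φ s) (theorem-sound ⊢φ (M [ σ ]ᴹ) F s)
  theorem-sound (mp ⊢φ⇒ψ ⊢φ) M F s =
    decidable-stable em λ s∼ψ → theorem-sound ⊢φ⇒ψ M F s (theorem-sound ⊢φ M F s , s∼ψ)
  theorem-sound (rule∘ ⊢φ⇒ψ) M F s ((s∘φ , sφ) , h) =
    h λ _ t sRt → decidable-stable em λ t∼ψ →
      theorem-sound ⊢φ⇒ψ M F t (s∘φ sφ t sRt , t∼ψ)

  soundness : ∀ {p q Γ φ} → Γ ⊢[ K4Axiom p q ] φ → Γ ⊨[ S4-frames ] φ
  soundness {φ = φ} (γs , γs∈Γ , ⊢γs⟹φ) M F s sΓ =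
    Equivalence.to (truth⇔⊨ M s φ)
      (⊩-⋀⁻ γs φ (Equivalence.from (truth⇔⊨ M s (⋀ γs ⟹ φ)) (theorem-sound ⊢γs⟹φ M F s))
        (All.map (λ {γ} γ∈Γ → Equivalence.from (truth⇔⊨ M s γ) (sΓ γ γ∈Γ)) γs∈Γ))

-- Derivability from premises.

module Completeness (em : ExcludedMiddle 0ℓ) (ext : Extensionality 0ℓ 0ℓ)
                    {P : Set} (p q : P) (p≢q : p ≢ q) where

  infix 4 ⊢_ _⊢_
  ⊢_ : Form P → Set
  ⊢ φ = Theorem (K4Axiom p q) φ

  _⊢_ : Pred (Form P) 0ℓ → Form P → Set
  Γ ⊢ φ = Γ ⊢[ K4Axiom p q ] φ

  tautology : ∀ {φ} → Tautology φ → ⊢ φ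
  tautology τ = axiom (inj₁ (taut τ))

  -- Propositional derivations are replaced by semantic arguments: truth-functional consequence
  -- makes `φ ⇒ ψ ⇒ χ` a tautology.
  ⊢-consequence₂ : ∀ {φ ψ χ} → ⊢ φ → ⊢ ψ →
                   (∀ v → v ⊩ φ → v ⊩ ψ → v ⊩ χ) → ⊢ χ
  ⊢-consequence₂ {φ} {ψ} {χ} ⊢φ ⊢ψ h = mp (mp (tautology λ v →
    ⊩-⇒⁺ φ (ψ ⇒ χ) λ vφ → ⊩-⇒⁺ ψ χ λ vψ → h v vφ vψ) ⊢φ) ⊢ψ

  consequence₂ : ∀ {Γ φ ψ χ} → Γ ⊢ φ → Γ ⊢ ψ →
                 (∀ v → v ⊩ φ → v ⊩ ψ → v ⊩ χ) → Γ ⊢ χ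
  consequence₂ {φ = φ} {ψ} {χ} (γs , γs∈Γ , ⊢φ) (δs , δs∈Γ , ⊢ψ) h =
    γs ++ δs , ++⁺ γs∈Γ δs∈Γ , ⊢-consequence₂ ⊢φ ⊢ψ λ v vφ vψ →
      ⊩-⋀⁺ (γs ++ δs) χ λ all →
        h v (⊩-⋀⁻ γs φ vφ (++⁻ˡ γs all)) (⊩-⋀⁻ δs ψ vψ (++⁻ʳ γs all))

  consequence : ∀ {Γ φ ψ} → Γ ⊢ φ → (∀ v → v ⊩ φ → v ⊩ ψ) → Γ ⊢ ψ
  consequence Γ⊢φ h = consequence₂ Γ⊢φ Γ⊢φ λ v vφ _ → h v vφ

  assumption : ∀ {Γ : Pred (Form P) 0ℓ} {φ} → φ ∈ Γ → Γ ⊢ φ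
  assumption {φ = φ} φ∈Γ = φ ∷ [] , φ∈Γ ∷ [] , tautology λ v → ⊩-⇒⁺ φ φ id

  deduction : ∀ {Γ Δ : Pred (Form P) 0ℓ} {φ ψ} →
              (∀ {γ} → γ ∈ Δ → γ ∈ Γ ⊎ γ ≡ φ) → Δ ⊢ ψ → Γ ⊢ φ ⇒ ψ
  deduction {Γ} {Δ} {φ} {ψ} split (γs , γs∈Δ , ⊢ψ) =
    let δs , δs∈Γ , enough = discharge γs∈Δ in
    δs , δs∈Γ , ⊢-consequence₂ ⊢ψ ⊢ψ λ v vψ _ →
      ⊩-⋀⁺ δs (φ ⇒ ψ) λ vδs → ⊩-⇒⁺ φ ψ λ vφ → ⊩-⋀⁻ γs ψ vψ (enough v vφ vδs)
    where
    discharge : ∀ {γs} → All (_∈ Δ) γs →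
                ∃[ δs ] All (_∈ Γ) δs × (∀ v → v ⊩ φ → All (v ⊩_) δs → All (v ⊩_) γs)
    discharge [] = [] , [] , λ _ _ _ → []
    discharge {γ ∷ _} (γ∈Δ ∷ γs∈Δ) with split γ∈Δ | discharge γs∈Δ
    ... | inj₁ γ∈Γ  | δs , δs∈Γ , enough =
      γ ∷ δs , γ∈Γ ∷ δs∈Γ , λ { v vφ (vγ ∷ vδs) → vγ ∷ enough v vφ vδs }
    ... | inj₂ refl | δs , δs∈Γ , enough =
      δs , δs∈Γ , λ v vφ vδs → vφ ∷ enough v vφ vδs

  -- Worlds and the Lindenbaum lemma.

  record World : Set where
    field
      val      : Form P → Bool
      theorems : ∀ {φ} → ⊢ φ → val ⊩ φ
  open World

  module _ {Γ : Pred (Form P) 0ℓ} {φ : Form P} (Γ⊬φ : ¬ (Γ ⊢ φ)) where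
    open Zorn em ext {Form P}

    _⁺ : Subset → Pred (Form P) 0ℓ
    X ⁺ = Γ ∪ (λ ψ → X ψ ≡ true)

    -- Finitely many premises involve finitely many members of the chain, and the largest of these
    -- suffices. The first alternative covers the empty chain.
    ⋃⁺-compact : ∀ D → Chain D → ∀ {γs} → All (_∈ ⋃ D ⁺) γs →
                 All (_∈ Γ) γs ⊎ (∃[ X ] D X ≡ true × All (_∈ X ⁺) γs)
    ⋃⁺-compact D chain [] = inj₁ []
    ⋃⁺-compact D chain (inj₁ γ∈Γ ∷ γs∈) with ⋃⁺-compact D chain γs∈
    ... | inj₁ γs∈Γ            = inj₁ (γ∈Γ ∷ γs∈Γ)
    ... | inj₂ (X , X∈D , γs∈X) = inj₂ (X , X∈D , inj₁ γ∈Γ ∷ γs∈X)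
    ⋃⁺-compact D chain (inj₂ γ∈⋃ ∷ γs∈) with ⋃⁻ D γ∈⋃ | ⋃⁺-compact D chain γs∈
    ... | Y , Y∈D , γ∈Y | inj₁ γs∈Γ = inj₂ (Y , Y∈D , inj₂ γ∈Y ∷ All.map inj₁ γs∈Γ)
    ... | Y , Y∈D , γ∈Y | inj₂ (X , X∈D , γs∈X) with chain X∈D Y∈D
    ...   | inj₁ X⊆Y = inj₂ (Y , Y∈D , inj₂ γ∈Y ∷ All.map widen γs∈X)
      where
      widen : ∀ {ψ} → ψ ∈ X ⁺ → ψ ∈ Y ⁺
      widen (inj₁ ψ∈Γ) = inj₁ ψ∈Γ
      widen (inj₂ ψ∈X) = inj₂ (X⊆Y _ ψ∈X)
    ...   | inj₂ Y⊆X = inj₂ (X , X∈D , inj₂ (Y⊆X _ γ∈Y) ∷ γs∈X)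

    lindenbaum : ∃[ w ] (∀ {γ} → γ ∈ Γ → val w ⊩ γ) × ¬ (val w ⊩ φ)
    lindenbaum with zorn (λ X → ¬ (X ⁺ ⊢ φ)) ⊬-⋃
      where
      ⊬-⋃ : ∀ D → Chain D → (∀ {X} → D X ≡ true → ¬ (X ⁺ ⊢ φ)) → ¬ (⋃ D ⁺ ⊢ φ)
      ⊬-⋃ D chain ⊬ (γs , γs∈ , ⊢φ) with ⋃⁺-compact D chain γs∈
      ... | inj₁ γs∈Γ             = Γ⊬φ (γs , γs∈Γ , ⊢φ)
      ... | inj₂ (X , X∈D , γs∈X) = ⊬ X∈D (γs , γs∈X , ⊢φ)
    ... | X , X⊬φ , maximal =
      record { val = X ; theorems = λ ⊢ψ → derivable ([] , [] , ⊢ψ) }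
      , (λ γ∈Γ → derivable (assumption (inj₁ γ∈Γ)))
      , λ Xφ → X⊬φ (subst (λ b → X ⁺ ⊢ literal b φ) Xφ (decides φ))
      where
      -- By maximality, adding `ψ` makes `φ` derivable; the deduction theorem then discharges `ψ`.
      refutes : ∀ {ψ} → X ψ ≢ true → X ⁺ ⊢ ψ ⇒ φ
      refutes {ψ} ψ∉X = deduction split
        (decidable-stable em λ ⊬ → ψ∉X (maximal ψ ⊬))
        where
        split : ∀ {γ} → γ ∈ insert ψ X ⁺ → γ ∈ X ⁺ ⊎ γ ≡ ψ
        split (inj₁ γ∈Γ) = inj₁ (inj₁ γ∈Γ)
        split (inj₂ γ∈)  with insert⁻ {ψ} {X} γ∈
        ... | inj₁ γ∈X = inj₁ (inj₂ γ∈X)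
        ... | inj₂ γ≡ψ = inj₂ γ≡ψ

      -- Relative to the underivable φ, "ψ is false" is expressed by ψ ⇒ φ.
      literal : Bool → Form P → Form P
      literal true  ψ = ψ
      literal false ψ = ψ ⇒ φ

      prime : ∀ ψ → X ⁺ ⊢ literal (X ψ) ψ
      prime ψ with X ψ in eq
      ... | true  = assumption (inj₂ eq)
      ... | false = refutes λ Xψ → contradiction (trans (sym eq) Xψ) λ ()

      negate : ∀ {ψ} → X ⁺ ⊢ ψ ⇒ φ → X ⁺ ⊢ ∼ ψ
      negate {ψ} ψ⇒φ with X (∼ ψ) | prime (∼ ψ)
      ... | true  | ∼ψ   = ∼ψ
      ... | false | ∼ψ⇒φ = ⊥-elim (X⊬φ (consequence₂ ψ⇒φ ∼ψ⇒φ cases))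
        where
        cases : ∀ v → v ⊩ ψ ⇒ φ → v ⊩ (∼ ψ) ⇒ φ → v ⊩ φ
        cases v h₁ h₂ with eval v ψ | eval v φ
        ... | _     | true  = refl
        ... | true  | false = h₁
        ... | false | false = h₂

      -- A Kalmár-style induction: `X` serves as an assignment to prime formulas, and its evaluation
      -- of any formula is matched by a derivation.
      decides : ∀ ψ → X ⁺ ⊢ literal (eval X ψ) ψ
      decides (var r) = prime (var r)
      decides (∘ ψ)   = prime (∘ ψ)
      decides (∼ ψ) with eval X ψ | decides ψ
      ... | true  | ⊢ψ  = consequence ⊢ψ λ v vψ → ⊩-⇒⁺ (∼ ψ) φ λ v∼ψ →
        contradiction (trans (sym v∼ψ) (cong not vψ)) λ ()
      ... | false | ψ⇒φ = negate ψ⇒φ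
      decides (ψ ∧ χ) with eval X ψ | decides ψ | eval X χ | decides χ
      ... | false | ψ⇒φ | _     | _   = consequence ψ⇒φ λ v h →
        ⊩-⇒⁺ (ψ ∧ χ) φ λ vψχ → ⊩-⇒⁻ ψ φ h (proj₁ (⊩-∧⁻ ψ χ vψχ))
      ... | true  | _   | false | χ⇒φ = consequence χ⇒φ λ v h →
        ⊩-⇒⁺ (ψ ∧ χ) φ λ vψχ → ⊩-⇒⁻ χ φ h (proj₂ (⊩-∧⁻ ψ χ vψχ))
      ... | true  | ⊢ψ  | true  | ⊢χ  = consequence₂ ⊢ψ ⊢χ λ v → ⊩-∧⁺ ψ χ

      derivable : ∀ {ψ} → X ⁺ ⊢ ψ → X ⊩ ψ
      derivable {ψ} ⊢ψ with eval X ψ | decides ψ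
      ... | true  | _   = refl
      ... | false | ψ⇒φ = ⊥-elim (X⊬φ (consequence₂ ψ⇒φ ⊢ψ λ v → ⊩-⇒⁻ ψ φ))

  -- Axiom instances and the canonical model.

  assign : Form P → Form P → P → Form P
  assign φ ψ r with em {r ≡ p}
  ... | yes _ = φ
  ... | no _  = ψ

  assign-p : ∀ φ ψ → assign φ ψ p ≡ φ
  assign-p φ ψ with em {p ≡ p}
  ... | yes _  = refl
  ... | no p≢p = contradiction refl p≢p

  assign-q : ∀ φ ψ → assign φ ψ q ≡ ψ
  assign-q φ ψ with em {q ≡ p}
  ... | yes q≡p = contradiction (sym q≡p) p≢q
  ... | no _    = refl

  ⊢∼⇒∘ : ∀ φ → ⊢ (∼ φ) ⇒ (∘ φ)
  ⊢∼⇒∘ φ = us (λ _ → φ) (axiom (inj₁ ∼⇒∘))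

  ⊢∘4 : ∀ φ → ⊢ ((∘ φ) ∧ φ) ⇒ (∘ (∘ φ))
  ⊢∘4 φ = us (λ _ → φ) (axiom (inj₂ ∘4))

  ⊢∘∧ : ∀ φ ψ → ⊢ ((∘ φ) ∧ (∘ ψ)) ⇒ (∘ (φ ∧ ψ))
  ⊢∘∧ φ ψ = subst₂ (λ α β → ⊢ ((∘ α) ∧ (∘ β)) ⇒ (∘ (α ∧ β)))
    (assign-p φ ψ) (assign-q φ ψ) (us (assign φ ψ) (axiom (inj₁ ∘∧)))

  -- At points of reflexive frames `∘ ψ ∧ ψ` says that `ψ` holds at all successors, so this is the
  -- analogue of the set of `ψ` whose box holds at `w`.
  Essential : World → Pred (Form P) 0ℓ
  Essential w ψ = val w ⊩ (∘ ψ) ∧ ψ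

  essential-∘ : ∀ w φ → φ ∈ Essential w → (∘ φ) ∈ Essential w
  essential-∘ w φ h = ⊩-∧⁺ {v = val w} (∘ ∘ φ) (∘ φ)
    (⊩-⇒⁻ ((∘ φ) ∧ φ) (∘ ∘ φ) (theorems w (⊢∘4 φ)) h) (proj₁ (⊩-∧⁻ (∘ φ) φ h))

  essential-∧ : ∀ w φ ψ → φ ∈ Essential w → ψ ∈ Essential w → (φ ∧ ψ) ∈ Essential w
  essential-∧ w φ ψ hφ hψ =
    let w∘φ , wφ = ⊩-∧⁻ (∘ φ) φ hφ
        w∘ψ , wψ = ⊩-∧⁻ (∘ ψ) ψ hψ
    in ⊩-∧⁺ {v = val w} (∘ (φ ∧ ψ)) (φ ∧ ψ)
         (⊩-⇒⁻ {v = val w} ((∘ φ) ∧ (∘ ψ)) (∘ (φ ∧ ψ)) (theorems w (⊢∘∧ φ ψ))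
           (⊩-∧⁺ {v = val w} (∘ φ) (∘ ψ) w∘φ w∘ψ))
         (⊩-∧⁺ φ ψ wφ wψ)

  essential-foldl : ∀ w γ γs → γ ∈ Essential w → All (_∈ Essential w) γs →
                    foldl _∧_ γ γs ∈ Essential w
  essential-foldl w γ []       h []       = h
  essential-foldl w γ (δ ∷ γs) h (hδ ∷ hs) =
    essential-foldl w (γ ∧ δ) γs (essential-∧ w γ δ h hδ) hs

  essential-⇒ : ∀ w φ ψ → ⊢ φ ⇒ ψ → φ ∈ Essential w → val w ⊩ ∘ ψ
  essential-⇒ w φ ψ ⊢φ⇒ψ = ⊩-⇒⁻ ((∘ φ) ∧ φ) (∘ ψ) (theorems w (rule∘ ⊢φ⇒ψ))

  essential-⊢ : ∀ w φ → Essential w ⊢ φ → val w ⊩ ∘ φ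
  -- With no premises `⊤[ p ]` stands in for their conjunction; it unfolds to `var p ⇒ var p`.
  essential-⊢ w φ ([] , [] , ⊢φ) = essential-⇒ w ⊤[ p ] φ
    (⊢-consequence₂ ⊢φ ⊢φ λ v vφ _ → ⊩-⇒⁺ ⊤[ p ] φ λ _ → vφ)
    (⊩-∧⁺ {v = val w} (∘ ⊤[ p ]) ⊤[ p ] (theorems w (axiom (inj₁ ∘⊤)))
      (⊩-⇒⁺ {v = val w} (var p) (var p) id))
  essential-⊢ w φ (γ ∷ γs , h ∷ hs , ⊢φ) =
    essential-⇒ w (foldl _∧_ γ γs) φ ⊢φ (essential-foldl w γ γs h hs)

  canonical : World → Model P
  canonical w₀ = record
    { frame = record
      { S        = World
      ; nonempty = w₀
      ; R        = λ w u → ∀ φ → φ ∈ Essential w → val u ⊩ φ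
      }
    ; V = λ r w → val w ⊩ var r
    }

  canonical-S4 : ∀ w₀ → Model.frame (canonical w₀) ∈ S4-frames
  canonical-S4 _ =
      (λ φ h → proj₂ (⊩-∧⁻ (∘ φ) φ h))
    , λ {w} wRu uRv φ h →
        uRv φ (⊩-∧⁺ (∘ φ) φ (wRu (∘ φ) (essential-∘ w φ h)) (wRu φ h))

  -- The truth lemma and completeness.

  module _ (w₀ : World) where

    -- Both directions go together, since `∼ φ` and the premise in the clause for `∘ φ` reverse
    -- direction.
    truth⁺ : ∀ φ w → val w ⊩ φ → canonical w₀ , w ⊨ φ
    truth⁻ : ∀ φ w → canonical w₀ , w ⊨ φ → val w ⊩ φ

    truth⁺ (var r) w h  = h
    truth⁺ (∼ φ) w h wφ = contradiction (trans (sym h) (cong not (truth⁻ φ w wφ))) λ ()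
    truth⁺ (φ ∧ ψ) w h  =
      let hφ , hψ = ⊩-∧⁻ φ ψ h in truth⁺ φ w hφ , truth⁺ ψ w hψ
    truth⁺ (∘ φ) w h wφ u wRu = truth⁺ φ u (wRu φ (⊩-∧⁺ (∘ φ) φ h (truth⁻ φ w wφ)))

    truth⁻ (var r) w h = h
    truth⁻ (∼ φ) w w∼φ with eval (val w) φ in eq
    ... | true  = ⊥-elim (w∼φ (truth⁺ φ w eq))
    ... | false = refl
    truth⁻ (φ ∧ ψ) w (wφ , wψ) = ⊩-∧⁺ φ ψ (truth⁻ φ w wφ) (truth⁻ ψ w wψ)
    truth⁻ (∘ φ) w w∘φ = decidable-stable em λ w∌∘φ →
      let wφ : val w ⊩ φ
          -- If `φ` failed at `w`, the axiom `∼ p ⇒ ∘ p` would already give `∘ φ`.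
          wφ = decidable-stable em λ w∌φ → w∌∘φ
            (⊩-⇒⁻ (∼ φ) (∘ φ) (theorems w (⊢∼⇒∘ φ)) (¬⊩⇒⊩∼ w∌φ))
          u , wRu , u∌φ = lindenbaum {Essential w} {φ} (w∌∘φ ∘′ essential-⊢ w φ)
      in u∌φ (truth⁻ φ u (w∘φ (truth⁺ φ w wφ) u λ ψ → wRu {ψ}))
      where
      ¬⊩⇒⊩∼ : ¬ (val w ⊩ φ) → val w ⊩ ∼ φ
      ¬⊩⇒⊩∼ w∌φ with eval (val w) φ
      ... | true  = contradiction refl w∌φ
      ... | false = refl

  completeness : ∀ {Γ φ} → Γ ⊨[ S4-frames ] φ → Γ ⊢ φ
  completeness {Γ} {φ} Γ⊨φ = decidable-stable em λ Γ⊬φ →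
    let w , wΓ , w∌φ = lindenbaum Γ⊬φ in
    w∌φ (truth⁻ w φ w
      (Γ⊨φ (canonical w) (canonical-S4 w) w λ γ γ∈Γ → truth⁺ w γ w (wΓ γ∈Γ)))

theorem38 : ExcludedMiddle 0ℓ → Extensionality 0ℓ 0ℓ →
    (P : Set) (p q : P) → p ≢ q →
    (Γ : Pred (Form P) 0ℓ) (φ : Form P) →
    (Γ ⊢[ K4Axiom p q ] φ) ⇔ (Γ ⊨[ S4-frames ] φ)
theorem38 em ext P p q p≢q Γ φ =
  mk⇔ (Soundness.soundness em) (Completeness.completeness em ext p q p≢q)
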